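{- Let $k\geq 3$. There is no $k$-geodetic digraph with minimum out-degree at least $2$ and order $M(2,k)+2$ (where $M(2,k)=1+2+\dots+2^k$) whose in-degree sequence is $(1,1,1,2,\dots,2,3,3,3)$, i.e. exactly three vertices have in-degree $1$, exactly three have in-degree $3$, and all others have in-degree $2$.
   Context: A digraph is $k$-geodetic if for any two vertices $u,v$ there is at most one directed walk from $u$ to $v$ of length at most $k$. The in-degree sequence is the list of in-degrees in non-decreasing order. -}

module Defs where

open import Data.Nat using (ℕ; zero; suc; _+_; _*_; _^_; _≤_; _≡ᵇ_)
open import Data.Bool using (Bool; true; false; if_then_else_; T)
open import Data.Fin using (Fin)
open import Data.List using (List; map; allFin)
open import Data.Nat.ListAction using (sum)
open import Data.Sum using (_⊎_)
open import Data.Product using (Σ; _,_; _×_)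
open import Relation.Binary.PropositionalEquality using (_≡_)

Digraph : ℕ → Set
Digraph n = Fin n → Fin n → Bool

count : ∀ {n} → (Fin n → Bool) → ℕ
count {n} P = sum (map (λ v → if P v then 1 else 0) (allFin n))

outdeg : ∀ {n} → Digraph n → Fin n → ℕ
outdeg G u = count (λ v → G u v)

indeg : ∀ {n} → Digraph n → Fin n → ℕ
indeg G v = count (λ u → G u v)

data Walk {n} (G : Digraph n) : Fin n → Fin n → ℕ → Set where
  [] : ∀ {u} → Walk G u u 0
  _∷_ : ∀ {u w v ℓ} → T (G u w) → Walk G w v ℓ → Walk G u v (suc ℓ)

Geodetic : ∀ {n} → ℕ → Digraph n → Set
Geodetic {n} k G =
  ∀ (u v : Fin n) (ℓ m : ℕ) (p : Walk G u v ℓ) (q : Walk G u v m) →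
  ℓ ≤ k → m ≤ k → _≡_ {A = Σ ℕ (Walk G u v)} (ℓ , p) (m , q)

M : ℕ → ℕ → ℕ
M d zero = 1
M d (suc k) = M d k + d ^ suc k

InSeq111-333 : ∀ {n} → Digraph n → Set
InSeq111-333 {n} G =
  count (λ v → indeg G v ≡ᵇ 1) ≡ 3 ×
  count (λ v → indeg G v ≡ᵇ 3) ≡ 3 ×
  (∀ (v : Fin n) → indeg G v ≡ 1 ⊎ (indeg G v ≡ 2 ⊎ indeg G v ≡ 3))

{-# OPTIONS --safe #-}
module Submission where

-- Counting degrees shows that every out-degree is 2, so every vertex u misses
-- exactly two vertices within distance k, its outliers O(u).  The adjacency
-- matrix A commutes with I + A + ... + A^k, hence
--   indeg v + #{u′ ∈ N⁺(u) : v ∈ O(u′)} = 2 + #{x ∈ O(u) : x → v}.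
-- Let S and S′ be the sets of vertices of in-degree 1 and 3.  By the identity
-- every t ∈ S′ is a child of an outlier of u, and each s ∈ S is an outlier of a
-- child of u.  First, no t ∈ S′ is an outlier, and O(u) = {a, b} where a has two
-- children in S′, b has one, and each t ∈ S′ is a child of exactly one of a, b.
-- Next, some x has O(x) ⊆ S.  Let s be the third vertex of S.
--   * If s is an "a", then all a's lie in a set of two elements of S without
--     outlier in-neighbours, so outliers of type b form infinite walks, and
--     three consecutive ones need three different partners.
--   * If s is a "b", then all b's lie in a set {s₂, s₃} ⊆ S.  If their children
--     in S′ differ, the child of x whose b is the other one gives two short walks.
--     If they coincide, all a's share the two other vertices of S′ as children,
--     and comparing the walks to these two vertices gives a contradiction.

open import Defs
open import Data.Nat using (ℕ; zero; suc; _+_; _*_; _∸_; _^_; _≤_; z≤n; s≤s; _≡ᵇ_)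
open import Data.Nat.Properties
open import Data.Nat.ListAction as ListAction using ()
open import Data.Fin using (Fin; zero; suc)
import Data.Fin.Properties as Fin
open import Data.Bool using (Bool; true; false; if_then_else_; T)
open import Data.Empty using (⊥)
open import Data.Unit using (tt)
open import Data.List as List using ()
open import Data.List.Properties using (map-tabulate)
open import Data.Product using (∃; ∃₂; _,_; _×_; proj₁; proj₂)
open import Data.Sum using (_⊎_; inj₁; inj₂; [_,_]′)
open import Function using (_∘_)
open import Relation.Nullary using (¬_; Dec; yes; no; contradiction)
open import Relation.Binary.PropositionalEquality
open import Algebra.Properties.CommutativeSemigroup +-commutativeSemigroup using (x∙yz≈y∙xz)
open import Algebra.Properties.Semiring.Sum +-*-semiring
  using (sum; sum-cong-≗; ∑-distrib-+; ∑-comm; *-distribˡ-sum; *-distribʳ-sum)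

private variable
  n : ℕ

-- Finite sums of natural numbers.

module FiniteSums where

  abstract

    count≡sum : (P : Fin n → Bool) → count P ≡ sum λ v → if P v then 1 else 0
    count≡sum {n} P = trans (cong ListAction.sum (map-tabulate (λ v → v) indicator)) (go indicator)
      where
      indicator : Fin n → ℕ
      indicator v = if P v then 1 else 0
      go : ∀ {n} (f : Fin n → ℕ) → ListAction.sum (List.tabulate f) ≡ sum f
      go {zero} f = refl
      go {suc n} f = cong (f zero +_) (go (f ∘ suc))

    sum-const : ∀ n c → sum {n} (λ _ → c) ≡ n * c
    sum-const zero c = refl
    sum-const (suc n) c = cong (c +_) (sum-const n c)

    sum-mono : {f g : Fin n → ℕ} → (∀ v → f v ≤ g v) → sum f ≤ sum g
    sum-mono {zero} f≤g = z≤n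
    sum-mono {suc n} f≤g = +-mono-≤ (f≤g zero) (sum-mono (f≤g ∘ suc))

    sum-mono-tight : {f g : Fin n → ℕ} → (∀ v → f v ≤ g v) → sum g ≤ sum f → ∀ v → f v ≡ g v
    sum-mono-tight {suc n} {f} {g} f≤g Σg≤Σf = λ where
        zero → ≤-antisym (f≤g zero) (+-cancelʳ-≤ (sum (g ∘ suc)) _ _
          (≤-trans Σg≤Σf (+-monoʳ-≤ (f zero) (sum-mono (f≤g ∘ suc)))))
        (suc v) → sum-mono-tight (f≤g ∘ suc) (+-cancelˡ-≤ (g zero) _ _
          (≤-trans Σg≤Σf (+-monoˡ-≤ (sum (f ∘ suc)) (f≤g zero)))) v

    -- Associativity of the matrix product, for the row vector `f`, the matrix `g` and the column
    -- vector `h`.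
    sum-swap-* : ∀ {m} (f : Fin n → ℕ) (g : Fin n → Fin m → ℕ) (h : Fin m → ℕ) →
      sum (λ x → f x * sum (λ y → g x y * h y)) ≡ sum (λ y → sum (λ x → f x * g x y) * h y)
    sum-swap-* f g h = begin
      sum (λ x → f x * sum (λ y → g x y * h y))
        ≡⟨ sum-cong-≗ (λ x → *-distribˡ-sum (f x) (λ y → g x y * h y)) ⟩
      sum (λ x → sum (λ y → f x * (g x y * h y)))
        ≡⟨ ∑-comm (λ x y → f x * (g x y * h y)) ⟩
      sum (λ y → sum (λ x → f x * (g x y * h y)))
        ≡⟨ sum-cong-≗ (λ y → sum-cong-≗ (λ x → sym (*-assoc (f x) (g x y) (h y)))) ⟩
      sum (λ y → sum (λ x → f x * g x y * h y))
        ≡⟨ sum-cong-≗ (λ y → sym (*-distribʳ-sum (h y) (λ x → f x * g x y))) ⟩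
      sum (λ y → sum (λ x → f x * g x y) * h y) ∎
      where open ≡-Reasoning

    sum-*-+ : (f g h : Fin n → ℕ) →
      sum (λ x → f x * (g x + h x)) ≡ sum (λ x → f x * g x) + sum (λ x → f x * h x)
    sum-*-+ f g h = trans (sum-cong-≗ (λ x → *-distribˡ-+ (f x) (g x) (h x)))
      (∑-distrib-+ (λ x → f x * g x) (λ x → f x * h x))

    sum-+-* : (f g h : Fin n → ℕ) →
      sum (λ x → (f x + g x) * h x) ≡ sum (λ x → f x * h x) + sum (λ x → g x * h x)
    sum-+-* f g h = trans (sum-cong-≗ (λ x → *-distribʳ-+ (h x) (f x) (g x)))
      (∑-distrib-+ (λ x → f x * h x) (λ x → g x * h x))

    ≤-sum : (f : Fin n → ℕ) (x : Fin n) → f x ≤ sum f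
    ≤-sum f zero = m≤m+n _ _
    ≤-sum f (suc x) = ≤-trans (≤-sum (f ∘ suc) x) (m≤n+m _ _)

    sum-positive : (f : Fin n → ℕ) → 1 ≤ sum f → ∃ λ x → 1 ≤ f x
    sum-positive {suc n} f 1≤ with f zero in eq
    ... | suc _ = zero , subst (1 ≤_) (sym eq) (s≤s z≤n)
    ... | zero with x , p ← sum-positive (f ∘ suc) 1≤ = suc x , p

    1≤*⁻ : ∀ m n → 1 ≤ m * n → 1 ≤ m × 1 ≤ n
    1≤*⁻ (suc m) zero p = contradiction (subst (1 ≤_) (*-zeroʳ m) p) λ ()
    1≤*⁻ (suc m) (suc n) p = s≤s z≤n , s≤s z≤n

    1≤+⁻ : ∀ m {n} → 1 ≤ m + n → 1 ≤ m ⊎ 1 ≤ n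
    1≤+⁻ zero p = inj₂ p
    1≤+⁻ (suc m) p = inj₁ (s≤s z≤n)

    m+n≥1+b∧n≤b⇒m≥1 : ∀ b {m n} → suc b ≤ m + n → n ≤ b → 1 ≤ m
    m+n≥1+b∧n≤b⇒m≥1 b {zero} p q = contradiction (≤-trans p q) 1+n≰n
    m+n≥1+b∧n≤b⇒m≥1 b {suc m} p q = s≤s z≤n

    m+n≥1+b∧m≤b⇒n≥1 : ∀ b m {n} → suc b ≤ m + n → m ≤ b → 1 ≤ n
    m+n≥1+b∧m≤b⇒n≥1 b m {n} p = m+n≥1+b∧n≤b⇒m≥1 b (subst (suc b ≤_) (+-comm m n) p)

    m+n≡1∧m≥1⇒n≡0 : ∀ {m n} → m + n ≡ 1 → 1 ≤ m → n ≡ 0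
    m+n≡1∧m≥1⇒n≡0 {suc zero} eq _ = suc-injective eq
    m+n≡1∧m≥1⇒n≡0 {suc (suc m)} () _

    sum-≤1 : (f : Fin n → ℕ) → (∀ x → f x ≤ 1) → (∀ x y → 1 ≤ f x → 1 ≤ f y → x ≡ y) → sum f ≤ 1
    sum-≤1 {zero} f f≤1 uniq = z≤n
    sum-≤1 {suc n} f f≤1 uniq with sum (f ∘ suc) in eq
    ... | zero = subst (_≤ 1) (sym (+-identityʳ _)) (f≤1 zero)
    ... | suc m with f zero in eq₀
    ...   | zero = subst (_≤ 1) eq (sum-≤1 (f ∘ suc) (f≤1 ∘ suc)
              λ x y p q → Fin.suc-injective (uniq _ _ p q))
    ...   | suc _ with x , p ← sum-positive (f ∘ suc) (subst (1 ≤_) (sym eq) (s≤s z≤n))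
              with () ← uniq zero (suc x) (subst (1 ≤_) (sym eq₀) (s≤s z≤n)) p

  -- Kronecker deltas, and functions of small sum as sums of deltas.

  δ : Fin n → Fin n → ℕ
  δ zero zero = 1
  δ zero (suc _) = 0
  δ (suc _) zero = 0
  δ (suc x) (suc y) = δ x y

  abstract

    δ-refl : (x : Fin n) → δ x x ≡ 1
    δ-refl zero = refl
    δ-refl (suc x) = δ-refl x

    δ-sym : (x y : Fin n) → δ x y ≡ δ y x
    δ-sym zero zero = refl
    δ-sym zero (suc y) = refl
    δ-sym (suc x) zero = refl
    δ-sym (suc x) (suc y) = δ-sym x y

    δ⇒≡ : {x y : Fin n} → 1 ≤ δ x y → x ≡ y
    δ⇒≡ {x = zero} {zero} p = refl
    δ⇒≡ {x = suc x} {suc y} p = cong suc (δ⇒≡ p)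

    ≢⇒δ≡0 : {x y : Fin n} → x ≢ y → δ x y ≡ 0
    ≢⇒δ≡0 {x = x} {y} x≢y with δ x y in eq
    ... | zero = refl
    ... | suc _ = contradiction (δ⇒≡ (subst (1 ≤_) (sym eq) (s≤s z≤n))) x≢y

    1≤δ : {x y : Fin n} → x ≡ y → 1 ≤ δ x y
    1≤δ {x = x} refl = ≤-reflexive (sym (δ-refl x))

    sum-δ-* : (u : Fin n) (f : Fin n → ℕ) → sum (λ x → δ u x * f x) ≡ f u
    sum-δ-* {suc n} zero f = trans
      (cong₂ _+_ (*-identityˡ (f zero)) (trans (sum-const n 0) (*-zeroʳ n))) (+-identityʳ _)
    sum-δ-* (suc u) f = sum-δ-* u (f ∘ suc)

    sum-*-δ : (f : Fin n → ℕ) (v : Fin n) → sum (λ x → f x * δ x v) ≡ f v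
    sum-*-δ f v = trans (sum-cong-≗ λ x → trans (*-comm (f x) _) (cong (_* f x) (δ-sym x v))) (sum-δ-* v f)

    sum-δ : (u : Fin n) → sum (δ u) ≡ 1
    sum-δ u = trans (sum-cong-≗ λ x → sym (*-identityʳ (δ u x))) (sum-δ-* u (λ _ → 1))

    -- Repeating this removal of one unit turns a function with sum 1, 2 or 3 into as many `δ`s,
    -- which is how children, outliers and members of S become named vertices.
    peel : (g : Fin n → ℕ) (x : Fin n) → 1 ≤ g x →
      ∃ λ h → (∀ v → g v ≡ δ x v + h v) × sum g ≡ suc (sum h)
    peel {n} g x 1≤gx = h , g≡ , trans (sum-cong-≗ g≡) (trans (∑-distrib-+ (δ x) h) (cong (_+ sum h) (sum-δ x)))
      where
      h : Fin n → ℕ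
      h v = g v ∸ δ x v
      δ≤g : ∀ v → δ x v ≤ g v
      δ≤g v with x Fin.≟ v
      ... | yes refl = subst (_≤ g x) (sym (δ-refl x)) 1≤gx
      ... | no x≢v = subst (_≤ g v) (sym (≢⇒δ≡0 x≢v)) z≤n
      g≡ : ∀ v → g v ≡ δ x v + h v
      g≡ v = sym (m+[n∸m]≡n (δ≤g v))

    peel-≢ : {g h : Fin n → ℕ} {x y : Fin n} → (∀ v → g v ≡ δ x v + h v) → x ≢ y → 1 ≤ g y → 1 ≤ h y
    peel-≢ {h = h} {y = y} g≡ x≢y p = subst (1 ≤_) (trans (g≡ y) (cong (_+ h y) (≢⇒δ≡0 x≢y))) p

    sum≡1⇒δ : (g : Fin n → ℕ) → sum g ≡ 1 → ∃ λ x → ∀ v → g v ≡ δ x v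
    sum≡1⇒δ g eq with x , p ← sum-positive g (≤-reflexive (sym eq))
      with h , g≡ , eq′ ← peel g x p = x , λ v → trans (g≡ v) (trans (cong (δ x v +_) (h≡0 v)) (+-identityʳ _))
      where
      h≡0 : ∀ v → h v ≡ 0
      h≡0 v = n≤0⇒n≡0 (subst (h v ≤_) (suc-injective (trans (sym eq′) eq)) (≤-sum h v))

    sum≡2⇒δ+δ : (g : Fin n → ℕ) → sum g ≡ 2 → ∃₂ λ x y → ∀ v → g v ≡ δ x v + δ y v
    sum≡2⇒δ+δ g eq with x , p ← sum-positive g (subst (1 ≤_) (sym eq) (s≤s z≤n))
      with h , g≡ , eq′ ← peel g x p
      with y , h≡ ← sum≡1⇒δ h (suc-injective (trans (sym eq′) eq)) =
      x , y , λ v → trans (g≡ v) (cong (δ x v +_) (h≡ v))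

    sum≡3⇒δ+δ+δ : (g : Fin n → ℕ) → sum g ≡ 3 → {x y : Fin n} → x ≢ y → 1 ≤ g x → 1 ≤ g y →
      ∃ λ z → ∀ v → g v ≡ δ x v + (δ y v + δ z v)
    sum≡3⇒δ+δ+δ g eq {x} {y} x≢y p q with h , g≡ , eq′ ← peel g x p
      with h′ , h≡ , eq″ ← peel h y (peel-≢ g≡ x≢y q)
      with z , h′≡ ← sum≡1⇒δ h′ (suc-injective (trans (sym eq″) (suc-injective (trans (sym eq′) eq)))) =
      z , λ v → trans (g≡ v) (cong (δ x v +_) (trans (h≡ v) (cong (δ y v +_) (h′≡ v))))

    sum-≤1-unique : (f : Fin n → ℕ) → sum f ≤ 1 → {x y : Fin n} → 1 ≤ f x → 1 ≤ f y → x ≡ y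
    sum-≤1-unique f Σ≤1 {x} {y} p q with x Fin.≟ y
    ... | yes x≡y = x≡y
    ... | no x≢y with h , f≡ , eq ← peel f x p =
      contradiction (≤-trans (s≤s (≤-trans (peel-≢ f≡ x≢y q) (≤-sum h y))) (subst (_≤ 1) eq Σ≤1)) 1+n≰n

    sum-≥2⇒two : (f : Fin n → ℕ) → 2 ≤ sum f → (∀ x → f x ≤ 1) → ∃₂ λ x y → x ≢ y × 1 ≤ f x × 1 ≤ f y
    sum-≥2⇒two f 2≤ f≤1 with x , p ← sum-positive f (≤-trans (s≤s z≤n) 2≤)
      with h , f≡ , eq ← peel f x p
      with y , q ← sum-positive h (≤-pred (subst (2 ≤_) eq 2≤)) =
      x , y , x≢y , p , subst (1 ≤_) (sym (f≡ y)) (≤-trans q (m≤n+m _ _))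
      where
      x≢y : x ≢ y
      x≢y refl = 1+n≰n (≤-trans
        (subst (2 ≤_) (sym (trans (f≡ x) (cong (_+ h x) (δ-refl x)))) (s≤s q)) (f≤1 x))

    sum-δ+δ-* : {g : Fin n → ℕ} {x y : Fin n} → (∀ v → g v ≡ δ x v + δ y v) →
      (f : Fin n → ℕ) → sum (λ v → g v * f v) ≡ f x + f y
    sum-δ+δ-* {x = x} {y} g≡ f = trans (sum-cong-≗ λ v → cong (_* f v) (g≡ v))
      (trans (sum-+-* (δ x) (δ y) f) (cong₂ _+_ (sum-δ-* x f) (sum-δ-* y f)))

    δ+δ⇒≡ : {g : Fin n → ℕ} (x y : Fin n) → (∀ v → g v ≡ δ x v + δ y v) → ∀ {v} → 1 ≤ g v → v ≡ x ⊎ v ≡ y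
    δ+δ⇒≡ x y g≡ {v} p with 1≤+⁻ (δ x v) (subst (1 ≤_) (g≡ v) p)
    ... | inj₁ q = inj₁ (sym (δ⇒≡ q))
    ... | inj₂ q = inj₂ (sym (δ⇒≡ q))

    δ+δ-fst : {g : Fin n → ℕ} (x y : Fin n) → (∀ v → g v ≡ δ x v + δ y v) → 1 ≤ g x
    δ+δ-fst x y g≡ = subst (1 ≤_) (sym (trans (g≡ x) (cong (_+ δ y x) (δ-refl x)))) (s≤s z≤n)

    δ+δ-snd : {g : Fin n → ℕ} (x y : Fin n) → (∀ v → g v ≡ δ x v + δ y v) → 1 ≤ g y
    δ+δ-snd x y g≡ = δ+δ-fst y x (λ v → trans (g≡ v) (+-comm (δ x v) (δ y v)))

    ≰⇒≡0 : ∀ {m} → ¬ 1 ≤ m → m ≡ 0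
    ≰⇒≡0 {zero} _ = refl
    ≰⇒≡0 {suc m} ¬p = contradiction (s≤s z≤n) ¬p

    ≡suc⇒≥1 : ∀ {m c} → m ≡ suc c → 1 ≤ m
    ≡suc⇒≥1 refl = s≤s z≤n

    ≡0⇒≱1 : ∀ {m} → m ≡ 0 → ¬ 1 ≤ m
    ≡0⇒≱1 refl ()

    m+n≡1∧m≡0⇒n≥1 : ∀ {m n} → m + n ≡ 1 → m ≡ 0 → 1 ≤ n
    m+n≡1∧m≡0⇒n≥1 eq refl = ≤-reflexive (sym eq)

    m+n≡3⇒2+1 : ∀ m {n} → m + n ≡ 3 → m ≤ 2 → n ≤ 2 → (m ≡ 2 × n ≡ 1) ⊎ (m ≡ 1 × n ≡ 2)
    m+n≡3⇒2+1 0 refl _ (s≤s (s≤s ()))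
    m+n≡3⇒2+1 1 refl _ _ = inj₂ (refl , refl)
    m+n≡3⇒2+1 2 refl _ _ = inj₁ (refl , refl)
    m+n≡3⇒2+1 (suc (suc (suc _))) _ (s≤s (s≤s ())) _

    m+n≥3⇒≥2 : ∀ m {n} → 3 ≤ m + n → 2 ≤ m ⊎ 2 ≤ n
    m+n≥3⇒≥2 0 p = inj₂ (≤-trans (n≤1+n 2) p)
    m+n≥3⇒≥2 1 p = inj₂ (≤-pred p)
    m+n≥3⇒≥2 (suc (suc m)) p = inj₁ (s≤s (s≤s z≤n))

    sum-≤-cover : (π g h : Fin n → ℕ) → (∀ v → 1 ≤ π v → 1 ≤ g v + h v) →
      sum π ≤ sum (λ v → g v * π v) + sum (λ v → h v * π v)
    sum-≤-cover π g h cover = subst (sum π ≤_) (sum-+-* g h π) (sum-mono π≤)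
      where
      π≤ : ∀ v → π v ≤ (g v + h v) * π v
      π≤ v with π v | cover v
      ... | zero | _ = z≤n
      ... | suc c | 1≤ = subst (_≤ (g v + h v) * suc c) (*-identityˡ (suc c)) (*-monoˡ-≤ (suc c) (1≤ (s≤s z≤n)))

    sum-≡-cover : (π g h : Fin n → ℕ) → (∀ v → 1 ≤ π v → g v + h v ≡ 1) →
      sum (λ v → g v * π v) + sum (λ v → h v * π v) ≡ sum π
    sum-≡-cover π g h cover = trans (sym (sum-+-* g h π)) (sum-cong-≗ π≡)
      where
      π≡ : ∀ v → (g v + h v) * π v ≡ π v
      π≡ v with π v | cover v
      ... | zero | _ = *-zeroʳ (g v + h v)
      ... | suc c | eq = trans (cong (_* suc c) (eq (s≤s z≤n))) (*-identityˡ (suc c))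

    third : (g : Fin n → ℕ) → (∀ v → g v ≤ 1) → sum g ≡ 3 → {x y : Fin n} → x ≢ y → 1 ≤ g x → 1 ≤ g y →
      ∃ λ z → (∀ v → g v ≡ δ x v + (δ y v + δ z v)) × z ≢ x × z ≢ y × 1 ≤ g z
    third g g≤1 eq {x} {y} x≢y p q with z , g≡ ← sum≡3⇒δ+δ+δ g eq x≢y p q =
      z , g≡ , z≢x , z≢y ,
      subst (1 ≤_) (sym (g≡ z)) (≤-trans (≤-trans (1≤δ {x = z} refl) (m≤n+m _ (δ y z))) (m≤n+m _ (δ x z)))
      where
      z≢x : z ≢ x
      z≢x refl = 1+n≰n (≤-trans (subst (2 ≤_) (sym (g≡ z))
        (+-mono-≤ (1≤δ {x = z} refl) (≤-trans (1≤δ {x = z} refl) (m≤n+m _ (δ y z))))) (g≤1 z))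
      z≢y : z ≢ y
      z≢y refl = 1+n≰n (≤-trans (subst (2 ≤_) (sym (g≡ z))
        (≤-trans (+-mono-≤ (1≤δ {x = z} refl) (1≤δ {x = z} refl)) (m≤n+m _ (δ x z)))) (g≤1 z))

    sum-δ+δ+δ-* : {g : Fin n → ℕ} {x y z : Fin n} → (∀ v → g v ≡ δ x v + (δ y v + δ z v)) →
      (f : Fin n → ℕ) → sum (λ v → g v * f v) ≡ f x + (f y + f z)
    sum-δ+δ+δ-* {x = x} {y} {z} g≡ f = trans (sum-cong-≗ λ v → cong (_* f v) (g≡ v))
      (trans (sum-+-* (δ x) (λ v → δ y v + δ z v) f)
      (cong₂ _+_ (sum-δ-* x f) (sum-δ+δ-* {x = y} {z} (λ _ → refl) f)))

    pigeonhole : ∀ {A : Set} {s s′ x y z : A} → x ≡ s ⊎ x ≡ s′ → y ≡ s ⊎ y ≡ s′ → z ≡ s ⊎ z ≡ s′ →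
      x ≡ y ⊎ y ≡ z ⊎ x ≡ z
    pigeonhole (inj₁ refl) (inj₁ refl) _ = inj₁ refl
    pigeonhole (inj₂ refl) (inj₂ refl) _ = inj₁ refl
    pigeonhole (inj₁ refl) (inj₂ refl) (inj₁ refl) = inj₂ (inj₂ refl)
    pigeonhole (inj₁ refl) (inj₂ refl) (inj₂ refl) = inj₂ (inj₁ refl)
    pigeonhole (inj₂ refl) (inj₁ refl) (inj₁ refl) = inj₂ (inj₁ refl)
    pigeonhole (inj₂ refl) (inj₁ refl) (inj₂ refl) = inj₂ (inj₂ refl)

open FiniteSums

-- Counting walks, and the effect of geodecity on the counts.

module WalkCount {n} (G : Digraph n) where

  A : Fin n → Fin n → ℕ
  A u v = if G u v then 1 else 0

  A≤1 : ∀ u v → A u v ≤ 1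
  A≤1 u v with G u v
  ... | true = s≤s z≤n
  ... | false = z≤n

  A⇒edge : ∀ u v → 1 ≤ A u v → T (G u v)
  A⇒edge u v p with G u v
  ... | true = tt

  -- w ℓ u v and C m u v count the walks from u to v of length ℓ and at most m.
  w : ℕ → Fin n → Fin n → ℕ
  w zero u v = δ u v
  w (suc ℓ) u v = sum λ x → A u x * w ℓ x v

  C : ℕ → Fin n → Fin n → ℕ
  C zero u v = w zero u v
  C (suc m) u v = C m u v + w (suc m) u v

  abstract

    w-snoc : ∀ ℓ u v → w (suc ℓ) u v ≡ sum λ x → w ℓ u x * A x v
    w-snoc zero u v = trans (sum-*-δ (A u) v) (sym (sum-δ-* u (λ x → A x v)))
    w-snoc (suc ℓ) u v = trans (sum-cong-≗ λ x → cong (A u x *_) (w-snoc ℓ x v))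
      (sum-swap-* (A u) (w ℓ) (λ y → A y v))

    C-cons : ∀ m u v → C (suc m) u v ≡ δ u v + sum λ x → A u x * C m x v
    C-cons zero u v = refl
    C-cons (suc m) u v = begin
      C (suc m) u v + w (suc (suc m)) u v
        ≡⟨ cong (_+ w (suc (suc m)) u v) (C-cons m u v) ⟩
      δ u v + sum (λ x → A u x * C m x v) + w (suc (suc m)) u v
        ≡⟨ +-assoc (δ u v) _ _ ⟩
      δ u v + (sum (λ x → A u x * C m x v) + w (suc (suc m)) u v)
        ≡⟨ cong (δ u v +_) (sum-*-+ (A u) (λ x → C m x v) (λ x → w (suc m) x v)) ⟨
      δ u v + sum (λ x → A u x * C (suc m) x v) ∎
      where open ≡-Reasoning

    C-snoc : ∀ m u v → C (suc m) u v ≡ δ u v + sum λ x → C m u x * A x v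
    C-snoc zero u v = cong (δ u v +_) (w-snoc 0 u v)
    C-snoc (suc m) u v = begin
      C (suc m) u v + w (suc (suc m)) u v
        ≡⟨ cong₂ _+_ (C-snoc m u v) (w-snoc (suc m) u v) ⟩
      δ u v + sum (λ x → C m u x * A x v) + sum (λ x → w (suc m) u x * A x v)
        ≡⟨ +-assoc (δ u v) _ _ ⟩
      δ u v + (sum (λ x → C m u x * A x v) + sum (λ x → w (suc m) u x * A x v))
        ≡⟨ cong (δ u v +_) (sum-+-* (C m u) (w (suc m) u) (λ x → A x v)) ⟨
      δ u v + sum (λ x → C (suc m) u x * A x v) ∎
      where open ≡-Reasoning

    -- Both sides count the nonempty walks of length at most `suc m`, split after the first edge on
    -- the left and before the last edge on the right.
    A-C-commute : ∀ m u v → sum (λ x → A u x * C m x v) ≡ sum (λ x → C m u x * A x v)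
    A-C-commute m u v = +-cancelˡ-≡ (δ u v) _ _ (trans (sym (C-cons m u v)) (C-snoc m u v))

    w≤C : ∀ {ℓ m} → ℓ ≤ m → ∀ u v → w ℓ u v ≤ C m u v
    w≤C {m = zero} z≤n u v = ≤-refl
    w≤C {m = suc m} ℓ≤m u v with m≤n⇒m<n∨m≡n ℓ≤m
    ... | inj₁ ℓ<m = ≤-trans (w≤C (≤-pred ℓ<m) u v) (m≤m+n _ _)
    ... | inj₂ refl = m≤n+m _ _

    C-positive : ∀ m u v → 1 ≤ C m u v → ∃ λ ℓ → ℓ ≤ m × 1 ≤ w ℓ u v
    C-positive zero u v p = 0 , z≤n , p
    C-positive (suc m) u v p with 1≤+⁻ (C m u v) p
    ... | inj₂ q = suc m , ≤-refl , q
    ... | inj₁ q with ℓ , ℓ≤m , r ← C-positive m u v q = ℓ , m≤n⇒m≤1+n ℓ≤m , r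

    step : ∀ ℓ u {x v} → 1 ≤ A u x → 1 ≤ w ℓ x v → 1 ≤ w (suc ℓ) u v
    step ℓ u {x} {v} p q = ≤-trans (*-mono-≤ p q) (≤-sum (λ x → A u x * w ℓ x v) x)

    w-trans : ∀ i j u x v → 1 ≤ w i u x → 1 ≤ w j x v → 1 ≤ w (i + j) u v
    w-trans zero j u x v p q with refl ← δ⇒≡ {x = u} {x} p = q
    w-trans (suc i) j u x v p q with y , r ← sum-positive (λ y → A u y * w i y x) p
      with s , t ← 1≤*⁻ (A u y) _ r = step (i + j) u s (w-trans i j y x v t q)

    w⇒walk : ∀ ℓ u v → 1 ≤ w ℓ u v → Walk G u v ℓ
    w⇒walk zero u v p with refl ← δ⇒≡ {x = u} {v} p = []
    w⇒walk (suc ℓ) u v p with x , q ← sum-positive (λ x → A u x * w ℓ x v) p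
      with r , s ← 1≤*⁻ (A u x) _ q = A⇒edge u x r ∷ w⇒walk ℓ x v s

    edge⇒w : ∀ {u v} → 1 ≤ A u v → 1 ≤ w 1 u v
    edge⇒w {u} {v} p = step 0 u p (1≤δ {x = v} refl)

    module _ (outdeg≡2 : ∀ u → sum (A u) ≡ 2) where

      sum-w : ∀ ℓ u → sum (w ℓ u) ≡ 2 ^ ℓ
      sum-w zero u = sum-δ u
      sum-w (suc ℓ) u = begin
        sum (λ v → sum (λ x → A u x * w ℓ x v)) ≡⟨ ∑-comm (λ v x → A u x * w ℓ x v) ⟩
        sum (λ x → sum (λ v → A u x * w ℓ x v)) ≡⟨ sum-cong-≗ (λ x → sym (*-distribˡ-sum (A u x) (w ℓ x))) ⟩
        sum (λ x → A u x * sum (w ℓ x))         ≡⟨ sum-cong-≗ (λ x → cong (A u x *_) (sum-w ℓ x)) ⟩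
        sum (λ x → A u x * 2 ^ ℓ)               ≡⟨ *-distribʳ-sum (2 ^ ℓ) (A u) ⟨
        sum (A u) * 2 ^ ℓ                       ≡⟨ cong (_* 2 ^ ℓ) (outdeg≡2 u) ⟩
        2 ^ suc ℓ ∎
        where open ≡-Reasoning

      sum-C : ∀ m u → sum (C m u) ≡ M 2 m
      sum-C zero u = sum-δ u
      sum-C (suc m) u = trans (∑-distrib-+ (C m u) (w (suc m) u)) (cong₂ _+_ (sum-C m u) (sum-w (suc m) u))

    module _ {k} (geo : Geodetic k G) where

      walk-unique : ∀ {ℓ u v} (p q : Walk G u v ℓ) → ℓ ≤ k → p ≡ q
      walk-unique p q ℓ≤k with refl ← geo _ _ _ _ p q ℓ≤k ℓ≤k = refl

      w-length-unique : ∀ {i j u v} → i ≤ k → j ≤ k → 1 ≤ w i u v → 1 ≤ w j u v → i ≡ j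
      w-length-unique i≤k j≤k p q = cong proj₁ (geo _ _ _ _ (w⇒walk _ _ _ p) (w⇒walk _ _ _ q) i≤k j≤k)

      -- Each summand is at most 1 by induction, and two positive summands would give two walks of
      -- equal length with different first steps.
      w≤1 : ∀ ℓ → ℓ ≤ k → ∀ u v → w ℓ u v ≤ 1
      w≤1 zero _ u v with u Fin.≟ v
      ... | yes refl = ≤-reflexive (δ-refl u)
      ... | no u≢v = ≤-trans (≤-reflexive (≢⇒δ≡0 u≢v)) z≤n
      w≤1 (suc ℓ) ℓ≤k u v = sum-≤1 _
        (λ x → *-mono-≤ (A≤1 u x) (w≤1 ℓ (≤-trans (n≤1+n ℓ) ℓ≤k) x v))
        λ x y p q → head-≡ (walk-unique (walk x p) (walk y q) ℓ≤k)
        where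
        walk : ∀ x → 1 ≤ A u x * w ℓ x v → Walk G u v (suc ℓ)
        walk x p = A⇒edge u x (proj₁ (1≤*⁻ (A u x) _ p)) ∷ w⇒walk ℓ x v (proj₂ (1≤*⁻ (A u x) _ p))
        head-≡ : ∀ {x y} {e : T (G u x)} {f : T (G u y)} {p : Walk G x v ℓ} {q : Walk G y v ℓ} →
          _≡_ {A = Walk G u v (suc ℓ)} (e ∷ p) (f ∷ q) → x ≡ y
        head-≡ refl = refl

      -- Walks of one length are unique by `w≤1`; `w-length-unique` rules out two different lengths.
      C≤1 : ∀ m → m ≤ k → ∀ u v → C m u v ≤ 1
      C≤1 zero m≤k u v = w≤1 zero m≤k u v
      C≤1 (suc m) m≤k u v with C m u v in eq
      ... | zero = w≤1 (suc m) m≤k u v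
      ... | suc c with ℓ , ℓ≤m , p ← C-positive m u v (subst (1 ≤_) (sym eq) (s≤s z≤n))
          with w (suc m) u v in eq′
      ...   | zero = subst (_≤ 1) (sym (+-identityʳ (suc c)))
                (subst (_≤ 1) eq (C≤1 m (≤-trans (n≤1+n m) m≤k) u v))
      ...   | suc _ = contradiction
                (subst (_≤ m) (w-length-unique (≤-trans ℓ≤m (≤-trans (n≤1+n m) m≤k)) m≤k p
                  (subst (1 ≤_) (sym eq′) (s≤s z≤n))) ℓ≤m) 1+n≰n

-- The k of the theorem is suc k here.
module Counterexample {n} (G : Digraph n) (k : ℕ) (2≤k : 2 ≤ k) (n≡ : n ≡ M 2 (suc k) + 2)
  (geo : Geodetic (suc k) G) (2≤outdeg : ∀ u → 2 ≤ outdeg G u) (inseq : InSeq111-333 G) where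

  open WalkCount G

  -- In-degrees, and why all out-degrees are 2.

  module InDegrees where

    -- σ and τ are the indicators of S and S′.
    d σ τ : Fin n → ℕ
    d v = sum λ u → A u v
    σ v = if indeg G v ≡ᵇ 1 then 1 else 0
    τ v = if indeg G v ≡ᵇ 3 then 1 else 0

    data InDegree (v : Fin n) : Set where
      one   : d v ≡ 1 → σ v ≡ 1 → τ v ≡ 0 → InDegree v
      two   : d v ≡ 2 → σ v ≡ 0 → τ v ≡ 0 → InDegree v
      three : d v ≡ 3 → σ v ≡ 0 → τ v ≡ 1 → InDegree v

    abstract

      inDegree : ∀ v → InDegree v
      -- Abstracting over the constructors as well generalises `indeg G v` in their types, so that
      -- `σ v` and `τ v` reduce and `refl` fits.
      inDegree v with indeg G v | count≡sum (λ u → G u v) | proj₂ (proj₂ inseq) v | one {v} | two {v} | three {v}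
      ... | _ | eq | inj₁ refl        | c₁ | _  | _  = c₁ (sym eq) refl refl
      ... | _ | eq | inj₂ (inj₁ refl) | _  | c₂ | _  = c₂ (sym eq) refl refl
      ... | _ | eq | inj₂ (inj₂ refl) | _  | _  | c₃ = c₃ (sym eq) refl refl

      sum-σ : sum σ ≡ 3
      sum-σ = trans (sym (count≡sum (λ v → indeg G v ≡ᵇ 1))) (proj₁ inseq)

      sum-τ : sum τ ≡ 3
      sum-τ = trans (sym (count≡sum (λ v → indeg G v ≡ᵇ 3))) (proj₁ (proj₂ inseq))

      σ≤1 : ∀ v → σ v ≤ 1
      σ≤1 v with inDegree v
      ... | one _ eq _ = ≤-reflexive eq
      ... | two _ eq _ = ≤-trans (≤-reflexive eq) z≤n
      ... | three _ eq _ = ≤-trans (≤-reflexive eq) z≤n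

      τ≤1 : ∀ v → τ v ≤ 1
      τ≤1 v with inDegree v
      ... | one _ _ eq = ≤-trans (≤-reflexive eq) z≤n
      ... | two _ _ eq = ≤-trans (≤-reflexive eq) z≤n
      ... | three _ _ eq = ≤-reflexive eq

      σ⇒d : ∀ v → 1 ≤ σ v → d v ≡ 1
      σ⇒d v p with inDegree v
      ... | one eq _ _ = eq
      ... | two _ eq _ = contradiction p (≡0⇒≱1 eq)
      ... | three _ eq _ = contradiction p (≡0⇒≱1 eq)

      τ⇒d : ∀ v → 1 ≤ τ v → d v ≡ 3
      τ⇒d v p with inDegree v
      ... | one _ _ eq = contradiction p (≡0⇒≱1 eq)
      ... | two _ _ eq = contradiction p (≡0⇒≱1 eq)
      ... | three eq _ _ = eq

      ¬τ⇒d≤2 : ∀ v → ¬ 1 ≤ τ v → d v ≤ 2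
      ¬τ⇒d≤2 v ¬p with inDegree v
      ... | one eq _ _ = ≤-trans (≤-reflexive eq) (s≤s z≤n)
      ... | two eq _ _ = ≤-reflexive eq
      ... | three _ _ eq = contradiction (≡suc⇒≥1 eq) ¬p

      ¬σ⇒2≤d : ∀ v → ¬ 1 ≤ σ v → 2 ≤ d v
      ¬σ⇒2≤d v ¬p with inDegree v
      ... | one _ eq _ = contradiction (≡suc⇒≥1 eq) ¬p
      ... | two eq _ _ = ≤-reflexive (sym eq)
      ... | three eq _ _ = ≤-trans (n≤1+n 2) (≤-reflexive (sym eq))

      1≤d : ∀ v → 1 ≤ d v
      1≤d v with inDegree v
      ... | one eq _ _ = ≡suc⇒≥1 eq
      ... | two eq _ _ = ≡suc⇒≥1 eq
      ... | three eq _ _ = ≡suc⇒≥1 eq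

      d+σ≡2+τ : ∀ v → d v + σ v ≡ 2 + τ v
      d+σ≡2+τ v with inDegree v
      ... | one e f g = trans (cong₂ _+_ e f) (cong (2 +_) (sym g))
      ... | two e f g = trans (cong₂ _+_ e f) (cong (2 +_) (sym g))
      ... | three e f g = trans (cong₂ _+_ e f) (cong (2 +_) (sym g))

      sum-d : sum d ≡ n * 2
      sum-d = +-cancelʳ-≡ 3 _ _ (begin
        sum d + 3                   ≡⟨ cong (sum d +_) sum-σ ⟨
        sum d + sum σ               ≡⟨ ∑-distrib-+ d σ ⟨
        sum (λ v → d v + σ v)       ≡⟨ sum-cong-≗ d+σ≡2+τ ⟩
        sum (λ v → 2 + τ v)         ≡⟨ ∑-distrib-+ (λ _ → 2) τ ⟩
        sum {n} (λ _ → 2) + sum τ   ≡⟨ cong₂ _+_ (sum-const n 2) sum-τ ⟩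
        n * 2 + 3                   ∎)
        where open ≡-Reasoning

      -- The in-degrees add up to `n * 2`, since the three deficits cancel the three excesses. The
      -- out-degrees have the same total and are all at least 2, so none exceeds 2.
      outdeg≡2 : ∀ u → sum (A u) ≡ 2
      outdeg≡2 u = sym (sum-mono-tight {f = λ _ → 2} {λ u → sum (A u)}
        (λ u → subst (2 ≤_) (count≡sum (G u)) (2≤outdeg u))
        (≤-reflexive (trans (∑-comm A) (trans sum-d (sym (sum-const n 2))))) u)

    c₁ c₂ : Fin n → Fin n
    c₁ u = proj₁ (sum≡2⇒δ+δ (A u) (outdeg≡2 u))
    c₂ u = proj₁ (proj₂ (sum≡2⇒δ+δ (A u) (outdeg≡2 u)))

    abstract

      children : ∀ u v → A u v ≡ δ (c₁ u) v + δ (c₂ u) v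
      children u = proj₂ (proj₂ (sum≡2⇒δ+δ (A u) (outdeg≡2 u)))

      parent : ∀ x → ∃ λ u → 1 ≤ A u x
      parent x = sum-positive (λ u → A u x) (1≤d x)

  open InDegrees

  -- Outliers and the commutation identity.

  module Outliers where

    -- o u is the indicator of the outliers of u; the subtraction never truncates.
    o : Fin n → Fin n → ℕ
    o u v = 1 ∸ C (suc k) u v

    abstract

      o≤1 : ∀ u v → o u v ≤ 1
      o≤1 u v = m∸n≤m 1 (C (suc k) u v)

      o+C≡1 : ∀ u v → o u v + C (suc k) u v ≡ 1
      o+C≡1 u v = m∸n+n≡m (C≤1 geo (suc k) ≤-refl u v)

      sum-o : ∀ u → sum (o u) ≡ 2
      sum-o u = +-cancelʳ-≡ (M 2 (suc k)) _ _ (begin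
        sum (o u) + M 2 (suc k)            ≡⟨ cong (sum (o u) +_) (sum-C outdeg≡2 (suc k) u) ⟨
        sum (o u) + sum (C (suc k) u)      ≡⟨ ∑-distrib-+ (o u) (C (suc k) u) ⟨
        sum (λ v → o u v + C (suc k) u v)  ≡⟨ sum-cong-≗ (o+C≡1 u) ⟩
        sum {n} (λ _ → 1)                  ≡⟨ sum-const n 1 ⟩
        n * 1                              ≡⟨ *-identityʳ n ⟩
        n                                  ≡⟨ n≡ ⟩
        M 2 (suc k) + 2                    ≡⟨ +-comm (M 2 (suc k)) 2 ⟩
        2 + M 2 (suc k)                    ∎)
        where open ≡-Reasoning

    -- An entry of the matrix product of `A` and `o`: the term `#{u′ ∈ N⁺(u) : v ∈ O(u′)}` of the
    -- identity in the overview.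
    K : Fin n → Fin n → ℕ
    K u v = sum λ x → A u x * o x v

    abstract

      -- With `J` the all-ones matrix, `C (suc k)` is `J - o`. Commuting it with `A` gives
      -- `2 J - A o = J A - o A`, and the entries of `J A` are in-degrees. Rearranging avoids
      -- subtraction.
      d+K : ∀ u v → d v + K u v ≡ 2 + sum λ x → o u x * A x v
      d+K u v = begin
        d v + K u v   ≡⟨ cong (_+ K u v) d≡ ⟩
        P + Q + K u v ≡⟨ cong (_+ K u v) (+-comm P Q) ⟩
        Q + P + K u v ≡⟨ +-assoc Q P (K u v) ⟩
        Q + (P + K u v) ≡⟨ cong (Q +_) (+-comm P (K u v)) ⟩
        Q + (K u v + P) ≡⟨ cong (Q +_) 2≡ ⟨
        Q + 2         ≡⟨ +-comm Q 2 ⟩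
        2 + Q         ∎
        where
        open ≡-Reasoning
        P Q : ℕ
        P = sum λ x → C (suc k) u x * A x v
        Q = sum λ x → o u x * A x v
        d≡ : d v ≡ P + Q
        d≡ = trans (sum-cong-≗ λ x → sym (trans (cong (_* A x v) (o+C≡1 u x)) (*-identityˡ (A x v))))
          (trans (sum-+-* (o u) (C (suc k) u) (λ x → A x v)) (+-comm Q P))
        2≡ : 2 ≡ K u v + P
        2≡ = trans (sym (outdeg≡2 u))
          (trans (sum-cong-≗ λ x → sym (trans (cong (A u x *_) (o+C≡1 x v)) (*-identityʳ (A u x))))
          (trans (sum-*-+ (A u) (λ x → o x v) (λ x → C (suc k) x v))
            (cong (K u v +_) (A-C-commute (suc k) u v))))

      d+K≡2+A+A : ∀ u {p q} → (∀ v → o u v ≡ δ p v + δ q v) → ∀ v → d v + K u v ≡ 2 + (A p v + A q v)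
      d+K≡2+A+A u o≡ v = trans (d+K u v) (cong (2 +_) (sum-δ+δ-* o≡ (λ x → A x v)))

      K≡ : ∀ u v → K u v ≡ o (c₁ u) v + o (c₂ u) v
      K≡ u v = sum-δ+δ-* (children u) (λ x → o x v)

      o≤K : ∀ u x v → 1 ≤ A u x → 1 ≤ o x v → 1 ≤ K u v
      o≤K u x v p q = ≤-trans (*-mono-≤ p q) (≤-sum (λ x → A u x * o x v) x)

      K⇒o : ∀ u v → 1 ≤ K u v → ∃ λ x → 1 ≤ o x v
      K⇒o u v p with x , q ← sum-positive (λ x → A u x * o x v) p = x , proj₂ (1≤*⁻ (A u x) _ q)

      no-shortcut₂ : ∀ x y z → 1 ≤ A x z → 1 ≤ A x y → 1 ≤ A y z → ⊥
      no-shortcut₂ x y z p q r with () ←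
        w-length-unique geo {1} {2} {x} {z} (s≤s z≤n) (s≤s (≤-trans (n≤1+n 1) 2≤k))
        (edge⇒w p) (step 1 x q (edge⇒w r))

      -- Walks of lengths 1 and 3 both lie within the bound `suc k` because `2 ≤ k`.
      no-shortcut₃ : ∀ x y y′ z → 1 ≤ A x z → 1 ≤ A x y → 1 ≤ A y y′ → 1 ≤ A y′ z → ⊥
      no-shortcut₃ x y y′ z p q q′ r with () ←
        w-length-unique geo {1} {3} {x} {z} (s≤s z≤n) (s≤s 2≤k)
        (edge⇒w p) (step 2 x q (step 1 y q′ (edge⇒w r)))

      step-snoc : ∀ ℓ u x v → 1 ≤ w ℓ u x → 1 ≤ A x v → 1 ≤ w (suc ℓ) u v
      step-snoc ℓ u x v p q = subst (1 ≤_) (sym (w-snoc ℓ u v))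
        (≤-trans (*-mono-≤ p q) (≤-sum (λ x → w ℓ u x * A x v) x))

      ancestor : ∀ ℓ v → ∃ λ z → 1 ≤ w ℓ z v
      ancestor zero v = v , 1≤δ {x = v} refl
      ancestor (suc ℓ) v with y , p ← parent v with z , q ← ancestor ℓ y = z , step-snoc ℓ z y v q p

    -- Vertices of in-degree 3 are never outliers.

    τA : Fin n → ℕ
    τA x = sum λ v → A x v * τ v

    abstract

      A*τ≤A : ∀ x v → A x v * τ v ≤ A x v
      A*τ≤A x v = ≤-trans (*-monoʳ-≤ (A x v) (τ≤1 v)) (≤-reflexive (*-identityʳ (A x v)))

      τA≤2 : ∀ x → τA x ≤ 2
      τA≤2 x = subst (τA x ≤_) (outdeg≡2 x) (sum-mono (A*τ≤A x))

      outlier-meets-τ : ∀ u {p q} → (∀ v → o u v ≡ δ p v + δ q v) → ∀ t → 1 ≤ τ t → 1 + K u t ≡ A p t + A q t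
      outlier-meets-τ u {p} {q} o≡ t 1≤τ = +-cancelˡ-≡ 2 _ _
        (trans (cong (_+ K u t) (sym (τ⇒d t 1≤τ))) (d+K≡2+A+A u o≡ t))

      -- The two outliers of `u` together have all three vertices of S′ as children, and neither has
      -- more than two children.
      outlier⇒τA≥1 : ∀ u x → 1 ≤ o u x → 1 ≤ τA x
      outlier⇒τA≥1 u x p with y , z , o≡ ← sum≡2⇒δ+δ (o u) (sum-o u) =
        [ (λ { refl → 1≤y }) , (λ { refl → 1≤z }) ]′ (δ+δ⇒≡ y z o≡ p)
        where
        3≤ : 3 ≤ τA y + τA z
        3≤ = subst (_≤ τA y + τA z) sum-τ (sum-≤-cover τ (A y) (A z)
          λ t 1≤τ → subst (1 ≤_) (outlier-meets-τ u o≡ t 1≤τ) (s≤s z≤n))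
        1≤y : 1 ≤ τA y
        1≤y = m+n≥1+b∧n≤b⇒m≥1 2 3≤ (τA≤2 z)
        1≤z : 1 ≤ τA z
        1≤z = m+n≥1+b∧m≤b⇒n≥1 2 (τA y) 3≤ (τA≤2 y)

      -- For a parent `u` of `x`, the identity at `t` makes both outliers of `u` parents of `t`. As
      -- an outlier, `t` has a child `t′` in S′, and one of the outliers of `u` also has `t′` as a
      -- child: it reaches `t′` directly and through `t`.
      τ-not-outlier : ∀ x t → 1 ≤ τ t → ¬ 1 ≤ o x t
      τ-not-outlier x t 1≤τ 1≤o with u , u→x ← parent x
        with p , q , o≡ ← sum≡2⇒δ+δ (o u) (sum-o u)
        with t′ , r ← sum-positive (λ v → A t v * τ v) (outlier⇒τA≥1 x t 1≤o)
        with t→t′ , 1≤τ′ ← 1≤*⁻ (A t t′) _ r =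
        [ (λ p→t′ → no-shortcut₂ p t t′ p→t′ p→t t→t′) , (λ q→t′ → no-shortcut₂ q t t′ q→t′ q→t t→t′) ]′
          (1≤+⁻ (A p t′) (subst (1 ≤_) (outlier-meets-τ u o≡ t′ 1≤τ′) (s≤s z≤n)))
        where
        2≤ : 2 ≤ A p t + A q t
        2≤ = subst (2 ≤_) (outlier-meets-τ u o≡ t 1≤τ) (s≤s (o≤K u x t u→x 1≤o))
        p→t : 1 ≤ A p t
        p→t = m+n≥1+b∧n≤b⇒m≥1 1 2≤ (A≤1 q t)
        q→t : 1 ≤ A q t
        q→t = m+n≥1+b∧m≤b⇒n≥1 1 (A p t) 2≤ (A≤1 p t)

      C-τ≡1 : ∀ z t → 1 ≤ τ t → C (suc k) z t ≡ 1
      C-τ≡1 z t 1≤τ = trans (cong (_+ C (suc k) z t) (sym (≰⇒≡0 (τ-not-outlier z t 1≤τ)))) (o+C≡1 z t)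

      -- Go back `i` steps from each of two parents of `r`. If both searches ended in `t`, there
      -- would be two walks of length `suc i` from `t` to `r`.
      two-ancestors : ∀ i → i ≤ k → ∀ r t → 2 ≤ d r → ∃ λ z → z ≢ t × 1 ≤ w (suc i) z r
      two-ancestors i i≤k r t 2≤d
        with y₁ , y₂ , y₁≢y₂ , p₁ , p₂ ← sum-≥2⇒two (λ z → A z r) 2≤d (λ z → A≤1 z r) =
        choose (ancestor i y₁) (ancestor i y₂)
        where
        choose : (∃ λ z → 1 ≤ w i z y₁) → (∃ λ z → 1 ≤ w i z y₂) → ∃ λ z → z ≢ t × 1 ≤ w (suc i) z r
        choose (z₁ , q₁) (z₂ , q₂) with z₁ Fin.≟ t | z₂ Fin.≟ t
        ... | no z₁≢t | _ = z₁ , z₁≢t , step-snoc i z₁ y₁ r q₁ p₁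
        ... | yes _ | no z₂≢t = z₂ , z₂≢t , step-snoc i z₂ y₂ r q₂ p₂
        ... | yes refl | yes refl = contradiction (sum-≤1-unique (λ y → w i t y * A y r)
          (subst (_≤ 1) (w-snoc i t r) (w≤1 geo (suc i) (s≤s i≤k) t r)) (*-mono-≤ q₁ p₁) (*-mono-≤ q₂ p₂)) y₁≢y₂

      -- The exception `t` is there for `no-twins`, where the empty walk may spoil the transfer at
      -- one vertex; `two-ancestors` supplies a `z` that avoids it.
      no-common-reach : ∀ r r′ t → r ≢ r′ → r ≢ t → 2 ≤ d r →
        ¬ (∀ z → z ≢ t → 1 ≤ C k z r → 1 ≤ C k z r′)
      no-common-reach r r′ t r≢r′ r≢t 2≤d transfer =
        from-r (C-positive k r r′ (transfer r r≢t (≤-trans (1≤δ {x = r} refl) (w≤C {0} {k} z≤n r r))))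
        where
        -- The walks of lengths `suc (k ∸ suc j)` and `suc j` join to one of length exactly `suc k`,
        -- so a walk to `r′` of length at most `k` differs from it in length.
        from-z : ∀ j → suc j ≤ k → 1 ≤ w (suc j) r r′ → ∀ z → 1 ≤ w (suc (k ∸ suc j)) z r →
          ¬ (∃ λ ℓ → ℓ ≤ k × 1 ≤ w ℓ z r′)
        from-z j j<k p z q (ℓ , ℓ≤k , s) =
          1+n≰n (subst (_≤ k) (w-length-unique geo {ℓ} {suc k} {z} {r′} (m≤n⇒m≤1+n ℓ≤k) ≤-refl s
            (subst (λ m → 1 ≤ w m z r′) (cong suc (m∸n+n≡m j<k))
              (w-trans (suc (k ∸ suc j)) (suc j) z r r′ q p))) ℓ≤k)
        k∸j≤k : ∀ j → suc j ≤ k → suc (k ∸ suc j) ≤ k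
        k∸j≤k j j<k = subst (suc (k ∸ suc j) ≤_)
          (trans (sym (+-suc (k ∸ suc j) j)) (m∸n+n≡m j<k)) (s≤s (m≤m+n _ j))
        from-r : ¬ (∃ λ ℓ → ℓ ≤ k × 1 ≤ w ℓ r r′)
        from-r (zero , _ , p) = r≢r′ (δ⇒≡ {x = r} {r′} p)
        from-r (suc j , j<k , p) with z , z≢t , q ← two-ancestors (k ∸ suc j) (m∸n≤m k (suc j)) r t 2≤d =
          from-z j j<k p z q (C-positive k z r′ (transfer z z≢t
            (≤-trans q (w≤C {suc (k ∸ suc j)} {k} (k∸j≤k j j<k) z r))))

      -- Every vertex reaches t and t′ within k + 1 steps.  If these share two
      -- in-neighbours, then a vertex z other than t′ that reaches the third
      -- in-neighbour r of t within k steps also reaches the third in-neighbour r′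
      -- of t′ within k steps.  In particular r does, in ℓ steps say, and a z at
      -- distance k + 1 - ℓ from r has walks of length k + 1 and at most k to r′.
      no-twins : ∀ t t′ x y → t ≢ t′ → 1 ≤ τ t → 1 ≤ τ t′ → x ≢ y →
        1 ≤ A x t → 1 ≤ A y t → 1 ≤ A x t′ → 1 ≤ A y t′ →
        (∀ r → r ≢ x → 1 ≤ A r t → 2 ≤ d r) → ⊥
      no-twins t t′ x y t≢t′ 1≤τ 1≤τ′ x≢y x→t y→t x→t′ y→t′ 2≤d
        with r , in≡ , r≢x , _ , r→t ← third (λ z → A z t) (λ z → A≤1 z t) (τ⇒d t 1≤τ) x≢y x→t y→t
        with r′ , in≡′ , _ ← third (λ z → A z t′) (λ z → A≤1 z t′) (τ⇒d t′ 1≤τ′) x≢y x→t′ y→t′ =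
        no-common-reach r r′ t′ r≢r′ r≢t′ (2≤d r r≢x r→t) transfer
        where
        -- The unique walk from `z` to `s` within `suc k` steps is either empty or has its last edge
        -- from `x`, `y` or `r`.
        expand : ∀ {r s} → 1 ≤ τ s → (∀ v → A v s ≡ δ x v + (δ y v + δ r v)) →
          ∀ z → C k z x + (C k z y + (δ z s + C k z r)) ≡ 1
        expand {r} {s} 1≤τ in≡ z = begin
          C k z x + (C k z y + (δ z s + C k z r))
            ≡⟨ cong (C k z x +_) (x∙yz≈y∙xz (C k z y) (δ z s) (C k z r)) ⟩
          C k z x + (δ z s + (C k z y + C k z r))
            ≡⟨ x∙yz≈y∙xz (C k z x) (δ z s) _ ⟩
          δ z s + (C k z x + (C k z y + C k z r))
            ≡⟨ cong (δ z s +_) (sum-δ+δ+δ-* in≡ (C k z)) ⟨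
          δ z s + sum (λ v → A v s * C k z v)
            ≡⟨ cong (δ z s +_) (sum-cong-≗ λ v → *-comm (A v s) (C k z v)) ⟩
          δ z s + sum (λ v → C k z v * A v s)
            ≡⟨ C-snoc k z s ⟨
          C (suc k) z s
            ≡⟨ C-τ≡1 z s 1≤τ ⟩
          1 ∎
          where
          open ≡-Reasoning
        balance : ∀ z → δ z t + C k z r ≡ δ z t′ + C k z r′
        balance z = +-cancelˡ-≡ (C k z y) _ _ (+-cancelˡ-≡ (C k z x) _ _
          (trans (expand 1≤τ in≡ z) (sym (expand 1≤τ′ in≡′ z))))
        transfer : ∀ z → z ≢ t′ → 1 ≤ C k z r → 1 ≤ C k z r′
        transfer z z≢t′ p = subst (1 ≤_) (trans (balance z) (cong (_+ C k z r′) (≢⇒δ≡0 z≢t′)))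
          (≤-trans p (m≤n+m _ (δ z t)))
        r≢t′ : r ≢ t′
        r≢t′ refl = no-shortcut₂ x r t x→t x→t′ r→t
        -- With `r` and `r′` equal, `balance t` would leave the empty walk at `t` unmatched unless
        -- `t` is `t′`.
        r≢r′ : r ≢ r′
        r≢r′ refl = t≢t′ (δ⇒≡ (subst (1 ≤_) (+-cancelʳ-≡ (C k t r) _ _ (balance t)) (1≤δ {x = t} refl)))

  open Outliers

  -- The two types of outliers.

  module OutlierPairs where

    abstract

      1+K≡A+A : ∀ u {p q} → (∀ v → o u v ≡ δ p v + δ q v) → ∀ s → 1 ≤ σ s → K u s ≡ 1 + (A p s + A q s)
      1+K≡A+A u {p} {q} o≡ s 1≤σ = suc-injective (trans (cong (_+ K u s) (sym (σ⇒d s 1≤σ))) (d+K≡2+A+A u o≡ s))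

      K-τ≡0 : ∀ u t → 1 ≤ τ t → K u t ≡ 0
      K-τ≡0 u t 1≤τ = ≰⇒≡0 λ p → τ-not-outlier _ t 1≤τ (proj₂ (K⇒o u t p))

      outlier-meets-τ-once : ∀ u {p q} → (∀ v → o u v ≡ δ p v + δ q v) → ∀ t → 1 ≤ τ t → A p t + A q t ≡ 1
      outlier-meets-τ-once u o≡ t 1≤τ = trans (sym (outlier-meets-τ u o≡ t 1≤τ)) (cong suc (K-τ≡0 u t 1≤τ))

      -- Each of the three vertices of S′ is a child of exactly one outlier, and an outlier has only
      -- two children, so they split as 2 + 1. The larger share is put first.
      outliers : ∀ u → ∃₂ λ p q → (∀ v → o u v ≡ δ p v + δ q v) × τA p ≡ 2 × τA q ≡ 1
      outliers u with p , q , o≡ ← sum≡2⇒δ+δ (o u) (sum-o u) =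
        [ (λ (e , f) → p , q , o≡ , e , f)
        , (λ (e , f) → q , p , (λ v → trans (o≡ v) (+-comm (δ p v) (δ q v))) , f , e) ]′
          (m+n≡3⇒2+1 (τA p) (trans (sum-≡-cover τ (A p) (A q) (outlier-meets-τ-once u o≡)) sum-τ)
            (τA≤2 p) (τA≤2 q))

    a b : Fin n → Fin n
    a u = proj₁ (outliers u)
    b u = proj₁ (proj₂ (outliers u))

    abstract

      o≡δ+δ : ∀ u v → o u v ≡ δ (a u) v + δ (b u) v
      o≡δ+δ u = proj₁ (proj₂ (proj₂ (outliers u)))

      τA-a : ∀ u → τA (a u) ≡ 2
      τA-a u = proj₁ (proj₂ (proj₂ (proj₂ (outliers u))))

      τA-b : ∀ u → τA (b u) ≡ 1
      τA-b u = proj₂ (proj₂ (proj₂ (proj₂ (outliers u))))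

      a-outlier : ∀ u → 1 ≤ o u (a u)
      a-outlier u = δ+δ-fst (a u) (b u) (o≡δ+δ u)

      b-outlier : ∀ u → 1 ≤ o u (b u)
      b-outlier u = δ+δ-snd (a u) (b u) (o≡δ+δ u)

      τA≡2≢1 : ∀ {x y} → τA x ≡ 2 → τA y ≡ 1 → x ≢ y
      τA≡2≢1 e f refl with () ← trans (sym e) f

      outlier-2⇒≡a : ∀ u v → 1 ≤ o u v → τA v ≡ 2 → a u ≡ v
      outlier-2⇒≡a u v p e with δ+δ⇒≡ (a u) (b u) (o≡δ+δ u) p
      ... | inj₁ eq = sym eq
      ... | inj₂ eq = contradiction eq (τA≡2≢1 e (τA-b u))

      outlier-1⇒≡b : ∀ u v → 1 ≤ o u v → τA v ≡ 1 → b u ≡ v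
      outlier-1⇒≡b u v p e with δ+δ⇒≡ (a u) (b u) (o≡δ+δ u) p
      ... | inj₁ eq = contradiction (sym eq) (τA≡2≢1 (τA-a u) e)
      ... | inj₂ eq = sym eq

      outlier-class : ∀ u v → 1 ≤ o u v → τA v ≡ 2 ⊎ τA v ≡ 1
      outlier-class u v p with δ+δ⇒≡ (a u) (b u) (o≡δ+δ u) p
      ... | inj₁ eq = inj₁ (trans (cong τA eq) (τA-a u))
      ... | inj₂ eq = inj₂ (trans (cong τA eq) (τA-b u))

      a+b≡1 : ∀ u t → 1 ≤ τ t → A (a u) t + A (b u) t ≡ 1
      a+b≡1 u = outlier-meets-τ-once u {a u} {b u} (o≡δ+δ u)

      a→⇒¬b→ : ∀ u t → 1 ≤ τ t → 1 ≤ A (a u) t → ¬ 1 ≤ A (b u) t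
      a→⇒¬b→ u t 1≤τ p = ≡0⇒≱1 (m+n≡1∧m≥1⇒n≡0 (a+b≡1 u t 1≤τ) p)

      ¬b→⇒a→ : ∀ u t → 1 ≤ τ t → ¬ 1 ≤ A (b u) t → 1 ≤ A (a u) t
      ¬b→⇒a→ u t 1≤τ ¬p = m+n≡1∧m≡0⇒n≥1 (trans (+-comm (A (b u) t) (A (a u) t)) (a+b≡1 u t 1≤τ)) (≰⇒≡0 ¬p)

      ¬a→⇒b→ : ∀ u t → 1 ≤ τ t → ¬ 1 ≤ A (a u) t → 1 ≤ A (b u) t
      ¬a→⇒b→ u t 1≤τ ¬p = m+n≡1∧m≡0⇒n≥1 (a+b≡1 u t 1≤τ) (≰⇒≡0 ¬p)

      τA≡2⇒children-τ : ∀ x v → τA x ≡ 2 → 1 ≤ A x v → 1 ≤ τ v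
      τA≡2⇒children-τ x v e p = proj₂ (1≤*⁻ (A x v) _ (subst (1 ≤_) (sym
        (sum-mono-tight (A*τ≤A x) (≤-reflexive (trans (outdeg≡2 x) (sym e))) v)) p))

      τA≡1⇒τ-child : ∀ x → τA x ≡ 1 → ∃ λ t → 1 ≤ A x t × 1 ≤ τ t
      τA≡1⇒τ-child x e with t , p ← sum-positive (λ v → A x v * τ v) (≤-reflexive (sym e)) =
        t , 1≤*⁻ (A x t) _ p

      τA≡1⇒unique : ∀ x t t′ → τA x ≡ 1 → 1 ≤ τ t → 1 ≤ τ t′ → 1 ≤ A x t → 1 ≤ A x t′ → t ≡ t′
      τA≡1⇒unique x t t′ e 1≤τ 1≤τ′ p p′ =
        sum-≤1-unique (λ v → A x v * τ v) (≤-reflexive e) (*-mono-≤ p 1≤τ) (*-mono-≤ p′ 1≤τ′)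

      τA≡1⇒¬τ-child : ∀ x → τA x ≡ 1 → ∃ λ y → 1 ≤ A x y × ¬ 1 ≤ τ y
      τA≡1⇒¬τ-child x e with τ (c₁ x) in eq
      ... | zero = c₁ x , δ+δ-fst (c₁ x) (c₂ x) (children x) , ≡0⇒≱1 eq
      ... | suc _ = c₂ x , δ+δ-snd (c₁ x) (c₂ x) (children x) ,
        ≡0⇒≱1 (m+n≡1∧m≥1⇒n≡0 (trans (sym (sum-δ+δ-* (children x) τ)) e) (≡suc⇒≥1 eq))

      σ⇒K≥1 : ∀ u s → 1 ≤ σ s → 1 ≤ K u s
      σ⇒K≥1 u s 1≤σ = subst (1 ≤_) (sym (1+K≡A+A u {a u} {b u} (o≡δ+δ u) s 1≤σ)) (s≤s z≤n)

      -- Being a child of an outlier of `u` raises the right side of `d+K` to at least 3, while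
      -- `d y` is at most 2 outside S′; hence `K u y` is positive.
      outlier-child : ∀ u x y → 1 ≤ o u x → 1 ≤ A x y → ¬ 1 ≤ τ y → ∃ λ z → 1 ≤ o z y
      outlier-child u x y p q ¬τ = K⇒o u y (m+n≥1+b∧m≤b⇒n≥1 2 (d y)
        (subst (3 ≤_) (sym (d+K≡2+A+A u {a u} {b u} (o≡δ+δ u) y)) (s≤s (s≤s 1≤))) (¬τ⇒d≤2 y ¬τ))
        where
        1≤ : 1 ≤ A (a u) y + A (b u) y
        1≤ with δ+δ⇒≡ (a u) (b u) (o≡δ+δ u) p
        ... | inj₁ refl = ≤-trans q (m≤m+n _ _)
        ... | inj₂ refl = ≤-trans q (m≤n+m _ _)

      -- All three vertices of S are outliers of the two children of `u`, so one child has at least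
      -- two of them, which are then its only outliers.
      seed : Fin n → ∃ λ x → 1 ≤ σ (a x) × 1 ≤ σ (b x)
      seed u = [ (λ p → c₁ u , both (c₁ u) p) , (λ p → c₂ u , both (c₂ u) p) ]′ (m+n≥3⇒≥2 (S (c₁ u)) 3≤)
        where
        S : Fin n → ℕ
        S x = sum λ v → o x v * σ v
        3≤ : 3 ≤ S (c₁ u) + S (c₂ u)
        3≤ = subst (_≤ S (c₁ u) + S (c₂ u)) sum-σ (sum-≤-cover σ (o (c₁ u)) (o (c₂ u))
          λ s 1≤σ → subst (1 ≤_) (K≡ u s) (σ⇒K≥1 u s 1≤σ))
        both : ∀ x → 2 ≤ S x → 1 ≤ σ (a x) × 1 ≤ σ (b x)
        both x p = m+n≥1+b∧n≤b⇒m≥1 1 2≤ (σ≤1 (b x)) , m+n≥1+b∧m≤b⇒n≥1 1 (σ (a x)) 2≤ (σ≤1 (a x))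
          where
          2≤ : 2 ≤ σ (a x) + σ (b x)
          2≤ = subst (2 ≤_) (sum-δ+δ-* (o≡δ+δ x) σ) p

      A-children : ∀ u x → 1 ≤ A u x → x ≡ c₁ u ⊎ x ≡ c₂ u
      A-children u x = δ+δ⇒≡ (c₁ u) (c₂ u) (children u)

    -- f stands for a or b.  As s and s′ have in-degree 1, each is an outlier of a
    -- child of u; the two children share out the two of them.
    module _ (f : Fin n → Fin n) (s s′ : Fin n) (s≢s′ : s ≢ s′) (1≤σ : 1 ≤ σ s) (1≤σ′ : 1 ≤ σ s′)
      (f≡s : ∀ u → 1 ≤ o u s → f u ≡ s) (f≡s′ : ∀ u → 1 ≤ o u s′ → f u ≡ s′) where

      abstract

        share : ∀ u → (f (c₁ u) ≡ s × f (c₂ u) ≡ s′) ⊎ (f (c₁ u) ≡ s′ × f (c₂ u) ≡ s)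
        share u with 1≤+⁻ (o (c₁ u) s) (subst (1 ≤_) (K≡ u s) (σ⇒K≥1 u s 1≤σ))
                   | 1≤+⁻ (o (c₁ u) s′) (subst (1 ≤_) (K≡ u s′) (σ⇒K≥1 u s′ 1≤σ′))
        ... | inj₁ p | inj₁ q = contradiction (trans (sym (f≡s _ p)) (f≡s′ _ q)) s≢s′
        ... | inj₁ p | inj₂ q = inj₁ (f≡s _ p , f≡s′ _ q)
        ... | inj₂ p | inj₁ q = inj₂ (f≡s′ _ q , f≡s _ p)
        ... | inj₂ p | inj₂ q = contradiction (trans (sym (f≡s _ p)) (f≡s′ _ q)) s≢s′

        share-child : ∀ u → ∃ λ y → 1 ≤ A u y × f y ≡ s
        share-child u with share u
        ... | inj₁ (p , _) = c₁ u , δ+δ-fst (c₁ u) (c₂ u) (children u) , p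
        ... | inj₂ (_ , p) = c₂ u , δ+δ-snd (c₁ u) (c₂ u) (children u) , p

        -- Every vertex is a child of some `u`, to which `share` applies.
        two-valued : ∀ x → f x ≡ s ⊎ f x ≡ s′
        two-valued x with u , u→x ← parent x with A-children u x u→x | share u
        ... | inj₁ refl | inj₁ (p , _) = inj₁ p
        ... | inj₁ refl | inj₂ (p , _) = inj₂ p
        ... | inj₂ refl | inj₁ (_ , p) = inj₂ p
        ... | inj₂ refl | inj₂ (_ , p) = inj₁ p

        -- Otherwise `K u s` is at least 2, so `s` is an outlier of both children of `u`, and `f`
        -- takes the value `s` on both, leaving none for `s′`.
        no-outlier-parent : ∀ u x → 1 ≤ o u x → ¬ 1 ≤ A x s
        no-outlier-parent u x p q = absurd (share u)
          where
          1≤A+A : 1 ≤ A (a u) s + A (b u) s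
          1≤A+A with δ+δ⇒≡ (a u) (b u) (o≡δ+δ u) p
          ... | inj₁ refl = ≤-trans q (m≤m+n _ _)
          ... | inj₂ refl = ≤-trans q (m≤n+m _ _)
          2≤ : 2 ≤ o (c₁ u) s + o (c₂ u) s
          2≤ = subst (2 ≤_) (trans (sym (1+K≡A+A u {a u} {b u} (o≡δ+δ u) s 1≤σ)) (K≡ u s)) (s≤s 1≤A+A)
          c₁≡s : f (c₁ u) ≡ s
          c₁≡s = f≡s _ (m+n≥1+b∧n≤b⇒m≥1 1 2≤ (o≤1 (c₂ u) s))
          c₂≡s : f (c₂ u) ≡ s
          c₂≡s = f≡s _ (m+n≥1+b∧m≤b⇒n≥1 1 (o (c₁ u) s) 2≤ (o≤1 (c₁ u) s))
          absurd : ¬ ((f (c₁ u) ≡ s × f (c₂ u) ≡ s′) ⊎ (f (c₁ u) ≡ s′ × f (c₂ u) ≡ s))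
          absurd (inj₁ (_ , e)) = s≢s′ (trans (sym c₂≡s) e)
          absurd (inj₂ (e , _)) = s≢s′ (trans (sym c₁≡s) e)

  open OutlierPairs

  -- The third vertex of S, as an outlier of either type.

  module ThirdSource where

    abstract

      -- The child of `b x` in S′ is the one vertex of S′ that `a x` misses, so `a x` determines it.
      same-partner : ∀ x x′ t t′ → a x ≡ a x′ → 1 ≤ τ t → 1 ≤ τ t′ → 1 ≤ A (b x) t → 1 ≤ A (b x′) t′ → t ≡ t′
      same-partner x x′ t t′ eq 1≤τ 1≤τ′ p p′ = τA≡1⇒unique (b x′) t t′ (τA-b x′) 1≤τ 1≤τ′
        (¬a→⇒b→ x′ t 1≤τ λ q → a→⇒¬b→ x t 1≤τ (subst (λ y → 1 ≤ A y t) (sym eq) q) p) p′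

    module _ (s s′ : Fin n) (s≢s′ : s ≢ s′) (1≤σ : 1 ≤ σ s) (1≤σ′ : 1 ≤ σ s′) where

      -- The non-τ child of an outlier b x would have to be some b x′ again, and
      -- three consecutive ones have distinct τ-children by geodecity; but their
      -- partners a x take only two values.
      abstract

        no-a-pair : τA s ≡ 2 → τA s′ ≡ 2 → ⊥
        no-a-pair e e′ = chain s
          where
          a≡s : ∀ u → 1 ≤ o u s → a u ≡ s
          a≡s u p = outlier-2⇒≡a u s p e
          a≡s′ : ∀ u → 1 ≤ o u s′ → a u ≡ s′
          a≡s′ u p = outlier-2⇒≡a u s′ p e′
          a-two-valued : ∀ x → a x ≡ s ⊎ a x ≡ s′
          a-two-valued = two-valued a s s′ s≢s′ 1≤σ 1≤σ′ a≡s a≡s′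
          -- Every `a x′` is `s` or `s′`, and `no-outlier-parent` forbids both as children of the
          -- outlier `b x`.
          no-a-child : ∀ x x′ → ¬ 1 ≤ A (b x) (a x′)
          no-a-child x x′ p with a-two-valued x′
          ... | inj₁ eq = no-outlier-parent a s s′ s≢s′ 1≤σ 1≤σ′ a≡s a≡s′ x (b x) (b-outlier x)
                  (subst (λ y → 1 ≤ A (b x) y) eq p)
          ... | inj₂ eq = no-outlier-parent a s′ s (s≢s′ ∘ sym) 1≤σ′ 1≤σ a≡s′ a≡s x (b x) (b-outlier x)
                  (subst (λ y → 1 ≤ A (b x) y) eq p)
          next : ∀ x → ∃ λ x′ → 1 ≤ A (b x) (b x′)
          next x with y , b→y , ¬τ ← τA≡1⇒¬τ-child (b x) (τA-b x)
            with x′ , p ← outlier-child x (b x) y (b-outlier x) b→y ¬τ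
            with outlier-class x′ y p
          ... | inj₂ eq = x′ , subst (λ y → 1 ≤ A (b x) y) (sym (outlier-1⇒≡b x′ y p eq)) b→y
          ... | inj₁ eq = contradiction
            (subst (λ y → 1 ≤ A (b x) y) (sym (outlier-2⇒≡a x′ y p eq)) b→y) (no-a-child x x′)
          chain : Fin n → ⊥
          chain x₀ with x₁ , p₁ ← next x₀ with x₂ , p₂ ← next x₁
            with t₀ , q₀ , r₀ ← τA≡1⇒τ-child (b x₀) (τA-b x₀)
            with t₁ , q₁ , r₁ ← τA≡1⇒τ-child (b x₁) (τA-b x₁)
            with t₂ , q₂ , r₂ ← τA≡1⇒τ-child (b x₂) (τA-b x₂)
            -- Two equal partners force a common child in S′, reached from the earlier `b` both
            -- directly and along the chain, in 2 or 3 steps.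
            with pigeonhole (a-two-valued x₀) (a-two-valued x₁) (a-two-valued x₂)
          ... | inj₁ eq with refl ← same-partner x₀ x₁ t₀ t₁ eq r₀ r₁ q₀ q₁ =
                no-shortcut₂ (b x₀) (b x₁) t₀ q₀ p₁ q₁
          ... | inj₂ (inj₁ eq) with refl ← same-partner x₁ x₂ t₁ t₂ eq r₁ r₂ q₁ q₂ =
                no-shortcut₂ (b x₁) (b x₂) t₁ q₁ p₂ q₂
          ... | inj₂ (inj₂ eq) with refl ← same-partner x₀ x₂ t₀ t₂ eq r₀ r₂ q₀ q₂ =
                no-shortcut₃ (b x₀) (b x₁) (b x₂) t₀ q₀ p₁ p₂ q₂

    module _ (s₁ s₂ s₃ : Fin n) (σ≡ : ∀ v → σ v ≡ δ s₁ v + (δ s₂ v + δ s₃ v))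
      (e₁ : τA s₁ ≡ 2) (e₂ : τA s₂ ≡ 1) (e₃ : τA s₃ ≡ 1) where

      abstract

        σ⇒≡ : ∀ v → 1 ≤ σ v → v ≡ s₁ ⊎ v ≡ s₂ ⊎ v ≡ s₃
        σ⇒≡ v p with 1≤+⁻ (δ s₁ v) (subst (1 ≤_) (σ≡ v) p)
        ... | inj₁ q = inj₁ (sym (δ⇒≡ q))
        ... | inj₂ q with 1≤+⁻ (δ s₂ v) q
        ...   | inj₁ r = inj₂ (inj₁ (sym (δ⇒≡ r)))
        ...   | inj₂ r = inj₂ (inj₂ (sym (δ⇒≡ r)))

        -- Here `a y` has `t` but not `t′` as a child, so it differs from `s₁` and has in-degree 2.
        -- Being an outlier of the child `y` of `x`, it is by the identity a child of `a x` or
        -- `b x`; all children of `a x` are in S′, so it is `b x`, which then reaches `t` directly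
        -- and through `a y`.
        no-distinct-τ : ∀ t t′ x y → t ≢ t′ → 1 ≤ τ t → 1 ≤ τ t′ → a x ≡ s₁ →
          1 ≤ A (b x) t → 1 ≤ A x y → 1 ≤ A (b y) t′ → ⊥
        no-distinct-τ t t′ x y t≢t′ 1≤τ 1≤τ′ ax≡s₁ bx→t x→y by→t′ =
          no-shortcut₂ (b x) (a y) t bx→t bx→ay ay→t
          where
          ax→t′ : 1 ≤ A (a x) t′
          ax→t′ = ¬b→⇒a→ x t′ 1≤τ′ λ p → t≢t′ (τA≡1⇒unique (b x) t t′ (τA-b x) 1≤τ 1≤τ′ bx→t p)
          ay→t : 1 ≤ A (a y) t
          ay→t = ¬b→⇒a→ y t 1≤τ λ p → t≢t′ (τA≡1⇒unique (b y) t t′ (τA-b y) 1≤τ 1≤τ′ p by→t′)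
          ¬σ : ¬ 1 ≤ σ (a y)
          ¬σ p with σ⇒≡ (a y) p
          ... | inj₁ eq = a→⇒¬b→ y t′ 1≤τ′ (subst (λ z → 1 ≤ A z t′) (trans ax≡s₁ (sym eq)) ax→t′) by→t′
          ... | inj₂ (inj₁ eq) = τA≡2≢1 (τA-a y) e₂ eq
          ... | inj₂ (inj₂ eq) = τA≡2≢1 (τA-a y) e₃ eq
          ¬τ : ¬ 1 ≤ τ (a y)
          ¬τ p = τ-not-outlier y (a y) p (a-outlier y)
          d≡2 : d (a y) ≡ 2
          d≡2 = ≤-antisym (¬τ⇒d≤2 (a y) ¬τ) (¬σ⇒2≤d (a y) ¬σ)
          K≡A+A : K x (a y) ≡ A (a x) (a y) + A (b x) (a y)
          K≡A+A = +-cancelˡ-≡ 2 _ _ (trans (cong (_+ K x (a y)) (sym d≡2))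
            (d+K≡2+A+A x {a x} {b x} (o≡δ+δ x) (a y)))
          bx→ay : 1 ≤ A (b x) (a y)
          bx→ay with 1≤+⁻ (A (a x) (a y)) (subst (1 ≤_) K≡A+A (o≤K x y (a y) x→y (a-outlier y)))
          ... | inj₁ p = contradiction (τA≡2⇒children-τ (a x) (a y) (τA-a x) p) ¬τ
          ... | inj₂ p = p

        -- With `t` below every `b`, the other two vertices of S′ lie below every `a`. Thus `s₁` and
        -- `a s₁` are two common parents, distinct because no vertex is its own outlier, and
        -- `no-twins` applies: `s₂` and `s₃` have only `t` as a child in S′, so `s₁` is the only
        -- parent of `t′` in S.
        no-common-τ : ∀ t x → 1 ≤ τ t → (∀ x → 1 ≤ A (b x) t) → 1 ≤ A s₂ t → 1 ≤ A s₃ t → a x ≡ s₁ → ⊥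
        no-common-τ t x 1≤τ b→t s₂→t s₃→t ax≡s₁
          with h , τ≡ , eq ← peel τ t 1≤τ
          with t′ , t″ , t′≢t″ , p′ , p″ ← sum-≥2⇒two h (≤-reflexive (suc-injective (trans (sym sum-τ) eq)))
                 (λ v → ≤-trans (≤-trans (m≤n+m (h v) (δ t v)) (≤-reflexive (sym (τ≡ v)))) (τ≤1 v)) =
          no-twins t′ t″ s₁ (a s₁) t′≢t″ (τ-of t′ p′) (τ-of t″ p″) s₁≢a
            (s₁→ t′ p′) (a→ t′ p′ s₁) (s₁→ t″ p″) (a→ t″ p″ s₁) 2≤d
          where
          τ-of : ∀ v → 1 ≤ h v → 1 ≤ τ v
          τ-of v p = subst (1 ≤_) (sym (τ≡ v)) (≤-trans p (m≤n+m (h v) (δ t v)))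
          ≢t : ∀ v → 1 ≤ h v → t ≢ v
          ≢t v p refl = 1+n≰n (≤-trans (subst (2 ≤_) (sym (τ≡ v)) (+-mono-≤ (1≤δ {x = v} refl) p)) (τ≤1 v))
          ¬→ : ∀ v → 1 ≤ h v → ∀ y → τA y ≡ 1 → 1 ≤ A y t → ¬ 1 ≤ A y v
          ¬→ v p y e y→t y→v = ≢t v p (τA≡1⇒unique y t v e 1≤τ (τ-of v p) y→t y→v)
          a→ : ∀ v → 1 ≤ h v → ∀ y → 1 ≤ A (a y) v
          a→ v p y = ¬b→⇒a→ y v (τ-of v p) (¬→ v p (b y) (τA-b y) (b→t y))
          s₁→ : ∀ v → 1 ≤ h v → 1 ≤ A s₁ v
          s₁→ v p = subst (λ z → 1 ≤ A z v) ax≡s₁ (a→ v p x)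
          s₁≢a : s₁ ≢ a s₁
          s₁≢a s₁≡a = 1+n≰n (≤-trans (+-mono-≤ (subst (λ z → 1 ≤ o s₁ z) (sym s₁≡a) (a-outlier s₁))
            (≤-trans (1≤δ {x = s₁} refl) (w≤C {0} {suc k} z≤n s₁ s₁))) (≤-reflexive (o+C≡1 s₁ s₁)))
          2≤d : ∀ r → r ≢ s₁ → 1 ≤ A r t′ → 2 ≤ d r
          2≤d r r≢s₁ r→t′ = ¬σ⇒2≤d r λ q →
            [ r≢s₁ , [ (λ { refl → ¬→ t′ p′ r e₂ s₂→t r→t′ })
                 , (λ { refl → ¬→ t′ p′ r e₃ s₃→t r→t′ }) ]′ ]′ (σ⇒≡ r q)

        no-b-pair : ∀ x → a x ≡ s₁ → s₂ ≢ s₃ → 1 ≤ σ s₂ → 1 ≤ σ s₃ → ⊥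
        no-b-pair x ax≡s₁ s₂≢s₃ 1≤σ₂ 1≤σ₃ with t₂ , s₂→t₂ , 1≤τ₂ ← τA≡1⇒τ-child s₂ e₂
          with t₃ , s₃→t₃ , 1≤τ₃ ← τA≡1⇒τ-child s₃ e₃ = split (t₂ Fin.≟ t₃)
          where
          b≡s₂ : ∀ u → 1 ≤ o u s₂ → b u ≡ s₂
          b≡s₂ u p = outlier-1⇒≡b u s₂ p e₂
          b≡s₃ : ∀ u → 1 ≤ o u s₃ → b u ≡ s₃
          b≡s₃ u p = outlier-1⇒≡b u s₃ p e₃
          b-two-valued : ∀ x → b x ≡ s₂ ⊎ b x ≡ s₃
          b-two-valued = two-valued b s₂ s₃ s₂≢s₃ 1≤σ₂ 1≤σ₃ b≡s₂ b≡s₃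
          b-child₂ : ∃ λ y → 1 ≤ A x y × b y ≡ s₂
          b-child₂ = share-child b s₂ s₃ s₂≢s₃ 1≤σ₂ 1≤σ₃ b≡s₂ b≡s₃ x
          b-child₃ : ∃ λ y → 1 ≤ A x y × b y ≡ s₃
          b-child₃ = share-child b s₃ s₂ (s₂≢s₃ ∘ sym) 1≤σ₃ 1≤σ₂ b≡s₃ b≡s₂ x
          move : ∀ {y z t} → y ≡ z → 1 ≤ A z t → 1 ≤ A y t
          move refl p = p
          split : Dec (t₂ ≡ t₃) → ⊥
          split (yes t₂≡t₃) = no-common-τ t₂ x 1≤τ₂
            (λ y → [ (λ eq → move eq s₂→t₂) , (λ eq → move eq s₃→t₂) ]′ (b-two-valued y)) s₂→t₂ s₃→t₂ ax≡s₁
            where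
            s₃→t₂ : 1 ≤ A s₃ t₂
            s₃→t₂ = subst (λ t → 1 ≤ A s₃ t) (sym t₂≡t₃) s₃→t₃
          split (no t₂≢t₃) with b-two-valued x
          ... | inj₁ eq with y , x→y , eq′ ← b-child₃ =
                no-distinct-τ t₂ t₃ x y t₂≢t₃ 1≤τ₂ 1≤τ₃ ax≡s₁ (move eq s₂→t₂) x→y (move eq′ s₃→t₃)
          ... | inj₂ eq with y , x→y , eq′ ← b-child₂ =
                no-distinct-τ t₃ t₂ x y (t₂≢t₃ ∘ sym) 1≤τ₃ 1≤τ₂ ax≡s₁ (move eq s₃→t₃) x→y (move eq′ s₂→t₂)

  open ThirdSource

  impossible : ⊥
  -- Any vertex will do for `u`; the nonzero sum of `σ` shows that there is one.
  impossible with u , _ ← sum-positive σ (≡suc⇒≥1 sum-σ)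
    with x , 1≤σa , 1≤σb ← seed u
    with s , σ≡ , s≢a , s≢b , 1≤σs ← third σ σ≤1 sum-σ (τA≡2≢1 (τA-a x) (τA-b x)) 1≤σa 1≤σb
    -- A vertex of S is an outlier of some vertex, so `s` has one of the two outlier types.
    with v , p ← K⇒o x s (σ⇒K≥1 x s 1≤σs)
    with outlier-class v s p
  ... | inj₁ e = no-a-pair (a x) s (s≢a ∘ sym) 1≤σa 1≤σs (τA-a x) e
  ... | inj₂ e = no-b-pair (a x) (b x) s σ≡ (τA-a x) (τA-b x) e x refl (s≢b ∘ sym) 1≤σb 1≤σs

theorem8 : ∀ (k : ℕ) → 3 ≤ k → (G : Digraph (M 2 k + 2)) →
    Geodetic k G → (∀ u → 2 ≤ outdeg G u) → ¬ InSeq111-333 G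
theorem8 (suc k) (s≤s 2≤k) G geo 2≤outdeg inseq =
  Counterexample.impossible G k 2≤k refl geo 2≤outdeg inseq
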